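{- For every correlation-free cellular automaton (CFCA) $F$ with set of states $\{\#,0,1\}$ and every $t$, we have $\mathcal{S}_F^t\neq\mathcal{S}_{\mathrm{Parity}}$.
   Context: A (one-dimensional) stochastic cellular automaton is a tuple $(Q,R,V,V',f)$ where $Q$ (states) and $R$ (random symbols) are finite sets, $V=\{v_1,\dots,v_\rho\}$ and $V'=\{v'_1,\dots,v'_{\rho'}\}$ are finite subsets of $\mathbb{Z}$, and $f:Q^\rho\times R^{\rho'}\to Q$. It is a CFCA if $V'=\{0\}$. It is identified with its explicit global function $F:Q^{\mathbb{Z}}\times R^{\mathbb{Z}}\to Q^{\mathbb{Z}}$, $F(c,s)_z=f\big((c_{z+v_j})_j,(s_{z+v'_j})_j\big)$. Iterates: $F^0(c)=c$, $F^{t+1}(c,s^1,\dots,s^{t+1})=F(F^t(c,s^1,\dots,s^t),s^{t+1})$. $\mathcal{S}_F^t(c)$ is the law of $F^t(c,s^1,\dots,s^t)$ when $s^1,\dots,s^t$ are independent and each drawn from the uniform (i.i.d. uniform product) measure on $R^{\mathbb{Z}}$; $\mathcal{S}_F=\mathcal{S}_F^1$. $\mathrm{Parity}$ is the stochastic CA with $Q=\{\#,0,1\}$, $R=\{0,1\}$, $V=\{ -1,0,1\}$, $V'=\{ -1,0\}$ and local function given, for all $c_{ -1},c_0,c_1,s_{ -1},s_0\in\{0,1\}$ and $a,b\in\{\#,0,1\}$, by $f(a\#b,s_{ -1}s_0)=\#$; $f(\#c_0\#,s_{ -1}s_0)=0$; $f(\#c_0c_1,s_{ -1}s_0)=s_0$;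 $f(c_{ -1}c_0\#,s_{ -1}s_0)=s_{ -1}$; $f(c_{ -1}c_0c_1,s_{ -1}s_0)=s_{ -1}+s_0$ (mod 2). (It maps every $\{0,1\}$-word delimited by two consecutive $\#$ to an independent uniformly random word of the same length with even parity.) -}

module Defs where

open import Data.Nat as ℕ using (ℕ; zero; suc; s≤s)
import Data.Nat.Properties as ℕₚ
open import Data.Integer as ℤ using (ℤ; +_; ∣_∣; 0ℤ; -1ℤ; 1ℤ)
import Data.Integer.Properties as ℤₚ
open import Data.Rational using (ℚ; _/_)
open import Data.Parity.Base as ℙ using (0ℙ; 1ℙ) renaming (Parity to Bit)
open import Data.Fin as Fin using (Fin; toℕ; inject₁; fromℕ; fromℕ<)
import Data.Fin.Properties as Finₚ
open import Data.List as List using (List; []; _∷_; [_]; length; filter; allFin; cartesianProductWith)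
open import Data.List.Extrema.Nat using (max; xs≤max)
open import Data.List.Relation.Unary.All as All using (All; []; _∷_)
import Data.List.Relation.Unary.All.Properties as Allₚ
open import Data.List.Relation.Unary.AllPairs using ([]; _∷_)
open import Data.List.Relation.Unary.Unique.Propositional using (Unique)
open import Data.Vec as Vec using (Vec; []; _∷_; fromList; lookup; tabulate)
import Data.Vec.Properties as Vecₚ
open import Data.Product using (_,_; ∃)
open import Data.Bool using (if_then_else_)
open import Level using (0ℓ)
open import Function using (_∘_; _↔_; Inverse; mk↔ₛ′)
open import Function.Properties.Inverse using (↔⇒↣)
open import Relation.Nullary using (¬_; ⌊_⌋; yes; no; contradiction)
open import Relation.Nullary.Decidable using (via-injection)
open import Relation.Unary using (Pred; Decidable)
open import Relation.Binary.Definitions using (DecidableEquality)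
open import Relation.Binary.PropositionalEquality
  using (_≡_; refl; sym; trans; cong; cong₂; subst; module ≡-Reasoning)
open import Data.Integer.Tactic.RingSolver using (solve-∀)

Config : Set → Set
Config A = ℤ → A

-- The random symbols form a nonempty set, since the uniform measure on
-- configurations of random symbols has to exist.
record StochasticCA (Q : Set) : Set₁ where
  field
    R        : Set
    ∣Q∣      : ℕ
    ∣R∣-1    : ℕ
    Q-finite : Q ↔ Fin ∣Q∣
    R-finite : R ↔ Fin (suc ∣R∣-1)
    V V′     : List ℤ
    V-unique : Unique V
    V′-unique : Unique V′
    f        : Vec Q (length V) → Vec R (length V′) → Q

  ∣R∣ : ℕ
  ∣R∣ = suc ∣R∣-1

  _≟Q_ : DecidableEquality Q
  _≟Q_ = via-injection (↔⇒↣ Q-finite) Finₚ._≟_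

  global : Config Q → Config R → Config Q
  global c s z = f (Vec.map (λ v → c (z ℤ.+ v)) (fromList V))
                   (Vec.map (λ v → s (z ℤ.+ v)) (fromList V′))

  -- The random configuration used at the first step is s zero.
  iterate : (t : ℕ) → Config Q → (Fin t → Config R) → Config Q
  iterate zero    c s = c
  iterate (suc t) c s = global (iterate t c (s ∘ inject₁)) (s (fromℕ t))

  -- iterate t c s z only depends on the symbols s i p with ∣ p - z ∣ ≤ reach t
  -- (see iterate-local).
  reach : ℕ → ℕ
  reach t = t ℕ.* max 0 (List.map ∣_∣ V) ℕ.+ max 0 (List.map ∣_∣ V′)

open StochasticCA

IsCFCA : ∀ {Q} → StochasticCA Q → Set
IsCFCA F = V′ F ≡ [ 0ℤ ]

allWords : ∀ {A : Set} → List A → (n : ℕ) → List (Vec A n)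
allWords as zero    = [ [] ]
allWords as (suc n) = cartesianProductWith _∷_ as (allWords as n)

-- The configuration that carries the word w on the cells a, a+1, …, and the
-- constant symbol d everywhere else.
place : ∀ {A : Set} {n} → A → ℤ → Vec A n → Config A
place d a []      p = d
place d a (x ∷ w) p = if ⌊ p ℤₚ.≟ a ⌋ then x else place d (ℤ.suc a) w p

module _ {Q : Set} (F : StochasticCA Q) where

  allSymbols : List (R F)
  allSymbols = List.map (Inverse.from (R-finite F)) (allFin (∣R∣ F))

  background : R F
  background = Inverse.from (R-finite F) Fin.zero

  samples : (n t : ℕ) → List (Vec (Vec (R F) n) t)
  samples n t = allWords (allWords allSymbols n) t

  embed : ∀ {n t} → ℤ → Vec (Vec (R F) n) t → Fin t → Config (R F)
  embed a w i = place background a (lookup w i)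

  -- The measure of an event E about t independent uniform configurations,
  -- provided that E depends only on the symbols at the cells a, …, a+n-1: the
  -- proportion of all fillings of these cells (in the t configurations) that
  -- realise E.  The symbols outside of the window are then irrelevant.
  windowMeasure : ∀ {t} (a : ℤ) (n : ℕ) {E : Pred (Fin t → Config (R F)) 0ℓ} → Decidable E → ℚ
  windowMeasure {t} a n E? =
    + length (filter (E? ∘ embed a) (samples n t)) / ((∣R∣ F ℕ.^ n) ℕ.^ t)
    where instance
      nonZero : ℕ.NonZero ((∣R∣ F ℕ.^ n) ℕ.^ t)
      nonZero = ℕₚ.m^n≢0 (∣R∣ F ℕ.^ n) t ⦃ ℕₚ.m^n≢0 (∣R∣ F) n ⦄

factor : ∀ {A : Set} → Config A → ℤ → (n : ℕ) → Vec A n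
factor c z n = tabulate λ (i : Fin n) → c (z ℤ.+ + toℕ i)

-- A probability measure on Config Q, given by its values on the cylinders
-- [u]_z = { c ∣ factor c z n ≡ u }.  The finite disjoint unions of cylinders
-- form an algebra of sets that generates the product σ-algebra, so a
-- probability measure is determined by these values.
Law : Set → Set
Law Q = (z : ℤ) {n : ℕ} → Vec Q n → ℚ

infix 4 _≈_ _≋_ _≉_

_≈_ : ∀ {Q} → Law Q → Law Q → Set
_≈_ {Q} μ ν = (z : ℤ) {n : ℕ} (u : Vec Q n) → μ z u ≡ ν z u

module _ {Q : Set} (F : StochasticCA Q) where

  windowStart : ℕ → ℤ → ℤ
  windowStart t z = z ℤ.- + reach F t

  windowWidth : ℕ → ℕ → ℕ
  windowWidth t n = n ℕ.+ (reach F t ℕ.+ reach F t)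

  -- The window suffices for the cylinder event: see factor-local.
  𝒮^ : (t : ℕ) → Config Q → Law Q
  𝒮^ t c z {n} u =
    windowMeasure F (windowStart t z) (windowWidth t n)
      (λ (s : Fin t → Config (R F)) → Vecₚ.≡-dec (_≟Q_ F) (factor (iterate F t c s) z n) u)

  𝒮 : Config Q → Law Q
  𝒮 = 𝒮^ 1

_≋_ : ∀ {Q} → (Config Q → Law Q) → (Config Q → Law Q) → Set
_≋_ {Q} S T = (c : Config Q) → S c ≈ T c

_≉_ : ∀ {Q} → (Config Q → Law Q) → (Config Q → Law Q) → Set
S ≉ T = ¬ (S ≋ T)

data State : Set where
  #   : State
  bit : Bit → State

State↔Fin3 : State ↔ Fin 3
State↔Fin3 = mk↔ₛ′ to from to∘from from∘to
  where
  to : State → Fin 3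
  to #        = Fin.zero
  to (bit 0ℙ) = Fin.suc Fin.zero
  to (bit 1ℙ) = Fin.suc (Fin.suc Fin.zero)
  from : Fin 3 → State
  from Fin.zero                     = #
  from (Fin.suc Fin.zero)           = bit 0ℙ
  from (Fin.suc (Fin.suc Fin.zero)) = bit 1ℙ
  to∘from : ∀ i → to (from i) ≡ i
  to∘from Fin.zero                     = refl
  to∘from (Fin.suc Fin.zero)           = refl
  to∘from (Fin.suc (Fin.suc Fin.zero)) = refl
  from∘to : ∀ q → from (to q) ≡ q
  from∘to #        = refl
  from∘to (bit 0ℙ) = refl
  from∘to (bit 1ℙ) = refl

Bit↔Fin2 : Bit ↔ Fin 2
Bit↔Fin2 = mk↔ₛ′ to from to∘from from∘to
  where
  to : Bit → Fin 2
  to 0ℙ = Fin.zero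
  to 1ℙ = Fin.suc Fin.zero
  from : Fin 2 → Bit
  from Fin.zero           = 0ℙ
  from (Fin.suc Fin.zero) = 1ℙ
  to∘from : ∀ i → to (from i) ≡ i
  to∘from Fin.zero           = refl
  to∘from (Fin.suc Fin.zero) = refl
  from∘to : ∀ b → from (to b) ≡ b
  from∘to 0ℙ = refl
  from∘to 1ℙ = refl

parityRule : Vec State 3 → Vec Bit 2 → State
parityRule (_      ∷ #     ∷ _      ∷ []) _               = #
parityRule (#      ∷ bit _ ∷ #      ∷ []) _               = bit 0ℙ
parityRule (#      ∷ bit _ ∷ bit _  ∷ []) (s₋₁ ∷ s₀ ∷ []) = bit s₀
parityRule (bit _  ∷ bit _ ∷ #      ∷ []) (s₋₁ ∷ s₀ ∷ []) = bit s₋₁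
parityRule (bit _  ∷ bit _ ∷ bit _  ∷ []) (s₋₁ ∷ s₀ ∷ []) = bit (s₋₁ ℙ.+ s₀)

Parity : StochasticCA State
Parity = record
  { R         = Bit
  ; ∣Q∣       = 3
  ; ∣R∣-1     = 1
  ; Q-finite  = State↔Fin3
  ; R-finite  = Bit↔Fin2
  ; V         = -1ℤ ∷ 0ℤ ∷ 1ℤ ∷ []
  ; V′        = -1ℤ ∷ 0ℤ ∷ []
  ; V-unique  = ((λ ()) ∷ (λ ()) ∷ []) ∷ ((λ ()) ∷ []) ∷ [] ∷ []
  ; V′-unique = ((λ ()) ∷ []) ∷ [] ∷ []
  ; f         = parityRule
  }

-- The remaining lemmas justify the choice of the window in 𝒮^.

map-fromList-cong : ∀ {A B : Set} {g h : A → B} (xs : List A) →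
  All (λ x → g x ≡ h x) xs → Vec.map g (fromList xs) ≡ Vec.map h (fromList xs)
map-fromList-cong []       []         = refl
map-fromList-cong (x ∷ xs) (e ∷ es) = cong₂ _∷_ e (map-fromList-cong xs es)

∣∣≤max : (xs : List ℤ) → All (λ v → ∣ v ∣ ℕ.≤ max 0 (List.map ∣_∣ xs)) xs
∣∣≤max xs = Allₚ.map⁻ (xs≤max 0 (List.map ∣_∣ xs))

p-z≡[p-[z+v]]+v : ∀ p z v → p ℤ.- z ≡ (p ℤ.- (z ℤ.+ v)) ℤ.+ v
p-z≡[p-[z+v]]+v = solve-∀

z+v-z≡v : ∀ z v → (z ℤ.+ v) ℤ.- z ≡ v
z+v-z≡v = solve-∀

iterate-local : ∀ {Q} (F : StochasticCA Q) t (c : Config Q) (s s′ : Fin t → Config (R F)) z →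
  (∀ i p → ∣ p ℤ.- z ∣ ℕ.≤ reach F t → s i p ≡ s′ i p) →
  iterate F t c s z ≡ iterate F t c s′ z
iterate-local F zero    c s s′ z eq = refl
iterate-local F (suc t) c s s′ z eq = cong₂ (f F)
  (map-fromList-cong (V F) (All.map
    (λ {v} v≤r → iterate-local F t c _ _ (z ℤ.+ v) λ i p near → eq (inject₁ i) p (begin
      ∣ p ℤ.- z ∣                          ≡⟨ cong ∣_∣ (p-z≡[p-[z+v]]+v p z v) ⟩
      ∣ (p ℤ.- (z ℤ.+ v)) ℤ.+ v ∣          ≤⟨ ℤₚ.∣i+j∣≤∣i∣+∣j∣ (p ℤ.- (z ℤ.+ v)) v ⟩
      ∣ p ℤ.- (z ℤ.+ v) ∣ ℕ.+ ∣ v ∣        ≤⟨ ℕₚ.+-mono-≤ near v≤r ⟩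
      reach F t ℕ.+ r                      ≡⟨ ℕₚ.+-comm (reach F t) r ⟩
      r ℕ.+ (t ℕ.* r ℕ.+ r′)               ≡⟨ ℕₚ.+-assoc r (t ℕ.* r) r′ ⟨
      reach F (suc t)                      ∎))
    (∣∣≤max (V F))))
  (map-fromList-cong (V′ F) (All.map
    (λ {v} v≤r′ → eq (fromℕ t) (z ℤ.+ v) (begin
      ∣ (z ℤ.+ v) ℤ.- z ∣  ≡⟨ cong ∣_∣ (z+v-z≡v z v) ⟩
      ∣ v ∣                ≤⟨ v≤r′ ⟩
      r′                   ≤⟨ ℕₚ.m≤n+m r′ (suc t ℕ.* r) ⟩
      reach F (suc t)      ∎))
    (∣∣≤max (V′ F))))
  where
  open ℕₚ.≤-Reasoning
  r  = max 0 (List.map ∣_∣ (V F))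
  r′ = max 0 (List.map ∣_∣ (V′ F))

ball⊆window : ∀ N n z (j : Fin n) p → ∣ p ℤ.- (z ℤ.+ + toℕ j) ∣ ℕ.≤ N →
  ∃ λ (k : Fin (n ℕ.+ (N ℕ.+ N))) → p ≡ (z ℤ.- + N) ℤ.+ + toℕ k
ball⊆window N n z j p near with p ℤ.- (z ℤ.+ + toℕ j) in d
... | + m = fromℕ< bound , (begin
    p                                             ≡⟨ p≡ ⟩
    (z ℤ.+ + toℕ j) ℤ.+ + m                       ≡⟨ shuffle z (+ toℕ j) (+ m) (+ N) ⟩
    (z ℤ.- + N) ℤ.+ (+ toℕ j ℤ.+ (+ N ℤ.+ + m))   ≡⟨ cong (λ k → (z ℤ.- + N) ℤ.+ + k) (Finₚ.toℕ-fromℕ< bound) ⟨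
    (z ℤ.- + N) ℤ.+ + toℕ (fromℕ< bound)          ∎)
  where
  open ≡-Reasoning
  bound : toℕ j ℕ.+ (N ℕ.+ m) ℕ.< n ℕ.+ (N ℕ.+ N)
  bound = ℕₚ.+-mono-<-≤ (Finₚ.toℕ<n j) (ℕₚ.+-monoʳ-≤ N near)
  shuffle : ∀ z j m N → (z ℤ.+ j) ℤ.+ m ≡ (z ℤ.- N) ℤ.+ (j ℤ.+ (N ℤ.+ m))
  shuffle = solve-∀
  back : ∀ p q → p ≡ q ℤ.+ (p ℤ.- q)
  back = solve-∀
  p≡ : p ≡ (z ℤ.+ + toℕ j) ℤ.+ + m
  p≡ = trans (back p (z ℤ.+ + toℕ j)) (cong (λ x → (z ℤ.+ + toℕ j) ℤ.+ x) d)
... | ℤ.-[1+ m ] = fromℕ< bound , (begin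
    p                                                        ≡⟨ p≡ ⟩
    (z ℤ.+ + toℕ j) ℤ.+ ℤ.-[1+ m ]                           ≡⟨ shuffle z (+ toℕ j) (+ suc m) (+ N) ⟩
    (z ℤ.- + N) ℤ.+ (+ toℕ j ℤ.+ (+ N ℤ.- + suc m))          ≡⟨ cong (λ k → (z ℤ.- + N) ℤ.+ (+ toℕ j ℤ.+ k)) (trans (ℤₚ.m-n≡m⊖n N (suc m)) (ℤₚ.⊖-≥ near)) ⟩
    (z ℤ.- + N) ℤ.+ + (toℕ j ℕ.+ (N ℕ.∸ suc m))              ≡⟨ cong (λ k → (z ℤ.- + N) ℤ.+ + k) (Finₚ.toℕ-fromℕ< bound) ⟨
    (z ℤ.- + N) ℤ.+ + toℕ (fromℕ< bound)                     ∎)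
  where
  open ≡-Reasoning
  bound : toℕ j ℕ.+ (N ℕ.∸ suc m) ℕ.< n ℕ.+ (N ℕ.+ N)
  bound = ℕₚ.+-mono-<-≤ (Finₚ.toℕ<n j) (ℕₚ.≤-trans (ℕₚ.m∸n≤m N (suc m)) (ℕₚ.m≤m+n N N))
  shuffle : ∀ z j m N → (z ℤ.+ j) ℤ.- m ≡ (z ℤ.- N) ℤ.+ (j ℤ.+ (N ℤ.- m))
  shuffle = solve-∀
  back : ∀ p q → p ≡ q ℤ.+ (p ℤ.- q)
  back = solve-∀
  p≡ : p ≡ (z ℤ.+ + toℕ j) ℤ.+ ℤ.-[1+ m ]
  p≡ = trans (back p (z ℤ.+ + toℕ j)) (cong (λ x → (z ℤ.+ + toℕ j) ℤ.+ x) d)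

factor-local : ∀ {Q} (F : StochasticCA Q) t (c : Config Q) z n (s s′ : Fin t → Config (R F)) →
  (∀ i → factor (s i) (windowStart F t z) (windowWidth F t n)
       ≡ factor (s′ i) (windowStart F t z) (windowWidth F t n)) →
  factor (iterate F t c s) z n ≡ factor (iterate F t c s′) z n
factor-local F t c z n s s′ eq = Vecₚ.tabulate-cong λ j →
  iterate-local F t c s s′ (z ℤ.+ + toℕ j) λ i p near →
    let k , p≡ = ball⊆window (reach F t) n z j p near in
    subst (λ p → s i p ≡ s′ i p) (sym p≡) (begin
      s i (windowStart F t z ℤ.+ + toℕ k)                ≡⟨ Vecₚ.lookup∘tabulate _ k ⟨
      lookup (factor (s i) (windowStart F t z) _) k      ≡⟨ cong (λ w → lookup w k) (eq i) ⟩
      lookup (factor (s′ i) (windowStart F t z) _) k     ≡⟨ Vecₚ.lookup∘tabulate _ k ⟩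
      s′ i (windowStart F t z ℤ.+ + toℕ k)               ∎)
  where open ≡-Reasoning

factor-place : ∀ {A : Set} (d : A) a {n} (w : Vec A n) → factor (place d a w) a n ≡ w
factor-place d a []      = refl
factor-place {A} d a {suc n} (x ∷ w) = cong₂ _∷_ here
  (trans (Vecₚ.tabulate-cong there) (factor-place d (ℤ.suc a) w))
  where
  here : place d a (x ∷ w) (a ℤ.+ 0ℤ) ≡ x
  here with (a ℤ.+ 0ℤ) ℤₚ.≟ a
  ... | yes _ = refl
  ... | no ¬e = contradiction (ℤₚ.+-identityʳ a) ¬e
  shift : ∀ a k → a ℤ.+ (1ℤ ℤ.+ k) ≡ ((1ℤ ℤ.+ a) ℤ.+ k)
  shift = solve-∀
  there : ∀ (i : Fin n) → place d a (x ∷ w) (a ℤ.+ + suc (toℕ i)) ≡ place d (ℤ.suc a) w (ℤ.suc a ℤ.+ + toℕ i)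
  there i with (a ℤ.+ + suc (toℕ i)) ℤₚ.≟ a
  ... | no _  = cong (place d (ℤ.suc a) w) (shift a (+ toℕ i))
  ... | yes e with trans (sym (z+v-z≡v a (+ suc (toℕ i)))) (trans (cong (ℤ._- a) e) (ℤₚ.+-inverseʳ a))
  ...   | ()

{-# OPTIONS --safe #-}
module Submission where

-- Two equal laws have the same support, and every finite pattern of random
-- symbols has positive probability.  So if 𝒮^ F t were the law of Parity, every
-- finite factor of an outcome of F^t would be a factor of an outcome of Parity
-- and conversely (support-transfer).  This has two contradictory consequences.
--
-- The outcomes of Parity keep every # in place and have an even total between
-- two # (isBlank-Parity, total-Parity).  Since F is correlation-free, changing
-- the symbol that the last step reads at one cell changes at most that cell;
-- the two constraints then forbid any change, so the last step does not depend
-- on its random symbols (last-step-deterministic-between).  This uses a # on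
-- either side of the cell; F^t being local, the initial configuration can be
-- made blank far away without altering the cell (last-step-deterministic).
-- Hence, for t = m + 1, F acts deterministically on every configuration that is
-- reachable in m steps.  The set of these configurations is stable under F
-- (Reachable-step), so F stays deterministic along the whole orbit of any of
-- them (iterate-deterministic).
--
-- On the other hand, …##00##… is a possible outcome of Parity on itself, so F^t
-- can lead from it back to it, and it is itself reachable in t steps, a fortiori
-- in m steps.  Therefore F^t has a single outcome on …##00##…
-- (returning-constant), whereas Parity leads from it to both …##00##… and
-- …##11##….  For t = 0 the outcome is trivially unique.

open import Algebra.Properties.AbelianGroup using (∙-cancelˡ)
open import Data.Nat as ℕ using (ℕ; zero; suc)
import Data.Nat.Properties as ℕₚ
open import Data.Integer as ℤ using (ℤ; +_; -[1+_]; ∣_∣; 0ℤ; -1ℤ; 1ℤ)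
import Data.Integer.Properties as ℤₚ
open import Data.Integer.Tactic.RingSolver using (solve-∀)
open import Data.Rational using (Positive; _/_)
import Data.Rational.Properties as ℚₚ
open import Data.Parity.Base as ℙ using (0ℙ; 1ℙ) renaming (Parity to Bit)
import Data.Parity.Properties as ℙₚ
open import Data.Bool using (Bool; true; false; if_then_else_)
open import Data.Fin as Fin using (Fin; toℕ; inject₁; fromℕ; fromℕ<)
import Data.Fin.Properties as Finₚ
open import Data.List as List using (List; []; _∷_; length; filter)
open import Data.List.Extrema.Nat using (max)
open import Data.List.Membership.Propositional using (_∈_)
open import Data.List.Membership.Propositional.Properties
  using (∈-cartesianProductWith⁺; ∈-map⁺; ∈-allFin; ∈-filter⁺; ∈-filter⁻)
open import Data.List.Relation.Unary.All as All using (All; []; _∷_)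
open import Data.List.Relation.Unary.Any using (here)
open import Data.Product using (_×_; _,_; ∃; ∃₂; proj₂)
open import Data.Vec as Vec using (Vec; []; _∷_; lookup; tabulate)
import Data.Vec.Functional as VF
import Data.Vec.Properties as Vecₚ
open import Function using (_∘_; Inverse)
open import Level using (0ℓ)
open import Relation.Binary.PropositionalEquality
  using (_≡_; _≢_; _≗_; refl; sym; trans; cong; cong₂; subst; module ≡-Reasoning)
open import Relation.Nullary using (yes; no; ⌊_⌋; contradiction)
open import Relation.Unary using (Pred; Decidable)
open import Defs
open StochasticCA

-- Supports of laws

∈-allWords : ∀ {A : Set} {as : List A} → (∀ a → a ∈ as) →
  ∀ {n} (w : Vec A n) → w ∈ allWords as n
∈-allWords all []      = here refl
∈-allWords all (a ∷ w) = ∈-cartesianProductWith⁺ _∷_ (all a) (∈-allWords all w)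

∈-samples : ∀ {Q} (F : StochasticCA Q) {n t} (w : Vec (Vec (R F) n) t) → w ∈ samples F n t
∈-samples F = ∈-allWords (∈-allWords λ r →
  subst (_∈ allSymbols F) (Inverse.strictlyInverseʳ (R-finite F) r)
    (∈-map⁺ (Inverse.from (R-finite F)) (∈-allFin (Inverse.to (R-finite F) r))))

length-filter-nonZero : ∀ {A : Set} {P : Pred A 0ℓ} (P? : Decidable P) {xs x} →
  x ∈ xs → P x → ℕ.NonZero (length (filter P? xs))
length-filter-nonZero P? {xs} x∈xs px with filter P? xs | ∈-filter⁺ P? x∈xs px
... | _ ∷ _ | _ = _

length-filter-nonZero⁻¹ : ∀ {A : Set} {P : Pred A 0ℓ} (P? : Decidable P) xs →
  ℕ.NonZero (length (filter P? xs)) → ∃ P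
length-filter-nonZero⁻¹ P? xs nz with filter P? xs | (λ {x} → ∈-filter⁻ P? {v = x} {xs = xs})
... | x ∷ _ | member = x , proj₂ (member (here refl))

-- Only the vanishing of a measure has to be compared, not its value.
/-nonZero : ∀ k l m n .⦃ _ : ℕ.NonZero m ⦄ .⦃ _ : ℕ.NonZero n ⦄ →
  + k / m ≡ + l / n → ℕ.NonZero k → ℕ.NonZero l
/-nonZero k (suc l) m n eq k≢0 = _
/-nonZero k zero    m n ⦃ m≢0 ⦄ eq k≢0
  with () ← subst Positive (trans eq (ℚₚ.0/n≡0 n)) (ℚₚ.normalize-pos k m ⦃ m≢0 ⦄ ⦃ k≢0 ⦄)

-- If u is a possible outcome for F and has the same probability for G, then it
-- is a possible outcome for G.
support-transfer : ∀ {Q} (F G : StochasticCA Q) t t′ (c c′ : Config Q) z {n} (u : Vec Q n) →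
  𝒮^ F t c z u ≡ 𝒮^ G t′ c′ z u →
  (∃ λ s → factor (iterate F t c s) z n ≡ u) →
  ∃ λ s → factor (iterate G t′ c′ s) z n ≡ u
support-transfer F G t t′ c c′ z {n} u eq (s , realised) =
  let w , e = length-filter-nonZero⁻¹ (event G t′ c′ ∘ embed G (windowStart G t′ z)) (samples G _ t′)
        (/-nonZero _ _ _ _ ⦃ size≢0 F t ⦄ ⦃ size≢0 G t′ ⦄ eq
          (length-filter-nonZero (event F t c ∘ embed F a) (∈-samples F restriction)
            (trans (factor-local F t c z n _ _ same-window) realised)))
  in embed G (windowStart G t′ z) w , e
  where
  event : ∀ H τ e (σ : Fin τ → Config (R H)) → _
  event H τ e σ = Vecₚ.≡-dec (_≟Q_ H) (factor (iterate H τ e σ) z n) u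
  size≢0 : ∀ H τ → ℕ.NonZero ((∣R∣ H ℕ.^ windowWidth H τ n) ℕ.^ τ)
  size≢0 H τ = ℕₚ.m^n≢0 _ τ ⦃ ℕₚ.m^n≢0 (∣R∣ H) (windowWidth H τ n) ⦄
  a = windowStart F t z
  width = windowWidth F t n
  -- The sample of the window that agrees with s there.
  restriction : Vec (Vec (R F) width) t
  restriction = tabulate λ i → factor (s i) a width
  same-window : ∀ i → factor (embed F a restriction i) a width ≡ factor (s i) a width
  same-window i = trans (factor-place (background F) a (lookup restriction i))
                        (Vecₚ.lookup∘tabulate _ i)

-- Stated for a variable automaton: for a concrete one, comparing both sides
-- would evaluate the enumeration of the samples.
𝒮≡𝒮^1 : ∀ {Q} (F : StochasticCA Q) c z {n} (u : Vec Q n) → 𝒮 F c z u ≡ 𝒮^ F 1 c z u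
𝒮≡𝒮^1 F c z u = refl

-- Locality and reachability

module _ {Q : Set} (F : StochasticCA Q) where

  -- One step of F reads states at distance at most radius.
  radius : ℕ
  radius = max 0 (List.map ∣_∣ (V F))

  global-local : ∀ {c c′ : Config Q} s z →
    (∀ p → ∣ p ℤ.- z ∣ ℕ.≤ radius → c p ≡ c′ p) → global F c s z ≡ global F c′ s z
  global-local s z eq = cong (λ w → f F w (Vec.map (λ v → s (z ℤ.+ v)) (Vec.fromList (V′ F))))
    (map-fromList-cong (V F) (All.map
    (λ {v} v≤r → eq (z ℤ.+ v) (subst (ℕ._≤ radius) (cong ∣_∣ (sym (z+v-z≡v z v))) v≤r))
    (∣∣≤max (V F))))

  global-cong : ∀ {c c′ : Config Q} s → c ≗ c′ → global F c s ≗ global F c′ s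
  global-cong s eq z = global-local s z λ p _ → eq p

  iterate-local-config : ∀ t {c c′ : Config Q} s z →
    (∀ p → ∣ p ℤ.- z ∣ ℕ.≤ t ℕ.* radius → c p ≡ c′ p) →
    iterate F t c s z ≡ iterate F t c′ s z
  iterate-local-config zero    s z eq = eq z (ℕₚ.≤-reflexive (cong ∣_∣ (ℤₚ.+-inverseʳ z)))
  iterate-local-config (suc t) s z eq = global-local (s (fromℕ t)) z λ q near →
    iterate-local-config t (s ∘ inject₁) q λ p near′ → eq p (begin
      ∣ p ℤ.- z ∣                       ≡⟨ cong ∣_∣ (via p q z) ⟩
      ∣ (q ℤ.- z) ℤ.+ (p ℤ.- q) ∣       ≤⟨ ℤₚ.∣i+j∣≤∣i∣+∣j∣ (q ℤ.- z) (p ℤ.- q) ⟩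
      ∣ q ℤ.- z ∣ ℕ.+ ∣ p ℤ.- q ∣       ≤⟨ ℕₚ.+-mono-≤ near near′ ⟩
      radius ℕ.+ t ℕ.* radius           ∎)
    where
    open ℕₚ.≤-Reasoning
    via : ∀ p q z → p ℤ.- z ≡ (q ℤ.- z) ℤ.+ (p ℤ.- q)
    via = solve-∀

  -- iterate splits off the last step; this splits off the first one.
  iterate-front : ∀ t (c : Config Q) s →
    iterate F (suc t) c s ≡ iterate F t (global F c (s Fin.zero)) (s ∘ Fin.suc)
  iterate-front zero    c s = refl
  iterate-front (suc t) c s = cong (λ d → global F d (s (fromℕ (suc t)))) (iterate-front t c (s ∘ inject₁))

  -- The configurations that some initial configuration and some choice of the
  -- random symbols lead to in exactly t steps.
  Reachable : ℕ → Config Q → Set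
  Reachable t d = ∃₂ λ c s → d ≡ iterate F t c s

  -- The symbols w are those of u followed by s; they serve for all initial
  -- configurations at once.
  iterate-snoc : ∀ t (u : Fin t → Config (R F)) s →
    ∃ λ w → ∀ (c : Config Q) → global F (iterate F t c u) s ≡ iterate F (suc t) c w
  iterate-snoc zero    u s = (λ _ → s) , λ c → refl
  iterate-snoc (suc t) u s =
    let w , eq = iterate-snoc t (u ∘ Fin.suc) s
        w′     = u Fin.zero VF.∷ w
    in w′ , λ c → trans (cong (λ d → global F d s) (iterate-front t c u))
                    (trans (eq (global F c (u Fin.zero))) (sym (iterate-front (suc t) c w′)))

  -- The configuration after the first step is taken as the initial one.
  Reachable-forget : ∀ {t d} → Reachable (suc t) d → Reachable t d
  Reachable-forget {t} (c , s , eq) = _ , _ , trans eq (iterate-front t c s)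

  Reachable-step : ∀ {t d} s → Reachable t d → Reachable t (global F d s)
  Reachable-step {t} s (c , u , refl) =
    let w , eq = iterate-snoc t u s in Reachable-forget (c , w , eq c)

  Reachable-iterate : ∀ {t d} k s → Reachable t d → Reachable t (iterate F k d s)
  Reachable-iterate zero    s reach = reach
  Reachable-iterate (suc k) s reach = Reachable-step (s (fromℕ k)) (Reachable-iterate k (s ∘ inject₁) reach)

  -- On d, the outcome of one step does not depend on the random symbols.
  Deterministic : Config Q → Set
  Deterministic d = ∀ s s′ → global F d s ≗ global F d s′

  iterate-deterministic : ∀ {t} → (∀ {d} → Reachable t d → Deterministic d) →
    ∀ {d} → Reachable t d → ∀ k s s′ → iterate F k d s ≗ iterate F k d s′
  iterate-deterministic det reach zero    s s′ z = refl
  iterate-deterministic det reach (suc k) s s′ z = trans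
    (global-cong (s (fromℕ k)) (iterate-deterministic det reach k (s ∘ inject₁) (s′ ∘ inject₁)) z)
    (det (Reachable-iterate k (s′ ∘ inject₁) reach) (s (fromℕ k)) (s′ (fromℕ k)) z)

  -- The only place where F is required to be correlation-free.
  global-local-symbols : IsCFCA F → ∀ (c : Config Q) (s s′ : Config (R F)) z →
    s z ≡ s′ z → global F c s z ≡ global F c s′ z
  global-local-symbols cfca c s s′ z eq = cong (f F (Vec.map (λ v → c (z ℤ.+ v)) (Vec.fromList (V F))))
    (map-fromList-cong (V′ F)
    (subst (All (λ v → s (z ℤ.+ v) ≡ s′ (z ℤ.+ v))) (sym cfca)
      (subst (λ p → s p ≡ s′ p) (sym (ℤₚ.+-identityʳ z)) eq ∷ [])))

-- Outcomes of Parity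

isBlank : State → Bool
isBlank #       = true
isBlank (bit _) = false

-- The bit in a cell, where # counts as 0.
value : State → Bit
value #       = 0ℙ
value (bit b) = b

isBlank-value-injective : ∀ {x y} → isBlank x ≡ isBlank y → value x ≡ value y → x ≡ y
isBlank-value-injective {#}     {#}     _ _    = refl
isBlank-value-injective {bit _} {bit _} _ refl = refl

isBlank⇒≡# : ∀ {x} → isBlank x ≡ true → x ≡ #
isBlank⇒≡# {#} _ = refl

-- The parity of the number of cells that contain the bit 1.
total : ∀ {n} → Vec State n → Bit
total []      = 0ℙ
total (x ∷ w) = value x ℙ.+ total w

total-agree-elsewhere : ∀ {n} (g h : Fin n → State) k → (∀ i → i ≢ k → g i ≡ h i) →
  total (tabulate g) ≡ total (tabulate h) → value (g k) ≡ value (h k)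
total-agree-elsewhere g h Fin.zero    eq e = ℙₚ.+-cancelʳ-≡ (total (tabulate (h ∘ Fin.suc))) _ _
  (subst (λ w → value (g Fin.zero) ℙ.+ total w ≡ _) (Vecₚ.tabulate-cong λ i → eq (Fin.suc i) λ ()) e)
total-agree-elsewhere g h (Fin.suc k) eq e = total-agree-elsewhere (g ∘ Fin.suc) (h ∘ Fin.suc) k
  (λ i i≢k → eq (Fin.suc i) (i≢k ∘ Finₚ.suc-injective))
  (ℙₚ.+-cancelˡ-≡ (value (h Fin.zero)) _ _
    (subst (λ x → value x ℙ.+ total (tabulate (g ∘ Fin.suc)) ≡ _) (eq Fin.zero λ ()) e))

total-telescopes : ∀ n (y : ℕ → State) (h : ℕ → Bit) → (∀ i → value (y i) ≡ h i ℙ.+ h (suc i)) →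
  total (tabulate {n = n} (y ∘ toℕ)) ≡ h 0 ℙ.+ h n
total-telescopes zero    y h eq = sym (ℙₚ.p+p≡0ℙ (h 0))
total-telescopes (suc n) y h eq = begin
  value (y 0) ℙ.+ total (tabulate {n = n} (y ∘ suc ∘ toℕ))  ≡⟨ cong₂ ℙ._+_ (eq 0) (total-telescopes n (y ∘ suc) (h ∘ suc) (eq ∘ suc)) ⟩
  (h 0 ℙ.+ h 1) ℙ.+ (h 1 ℙ.+ h (suc n))             ≡⟨ ℙₚ.+-assoc (h 0) (h 1) _ ⟩
  h 0 ℙ.+ (h 1 ℙ.+ (h 1 ℙ.+ h (suc n)))             ≡⟨ cong (h 0 ℙ.+_) (ℙₚ.+-assoc (h 1) (h 1) _) ⟨
  h 0 ℙ.+ ((h 1 ℙ.+ h 1) ℙ.+ h (suc n))             ≡⟨ cong (λ b → h 0 ℙ.+ (b ℙ.+ h (suc n))) (ℙₚ.p+p≡0ℙ (h 1)) ⟩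
  h 0 ℙ.+ h (suc n)                                 ∎
  where open ≡-Reasoning

-- The contribution of the random symbol s, attached to the boundary between
-- two neighbouring cells in states x and y, to the new value of either cell.
link : State → State → Bit → Bit
link (bit _) (bit _) s = s
link (bit _) #       s = 0ℙ
link #       _       s = 0ℙ

link-#ʳ : ∀ x s → link x # s ≡ 0ℙ
link-#ʳ #       s = refl
link-#ʳ (bit _) s = refl

value-parityRule : ∀ x y z r s →
  value (parityRule (x ∷ y ∷ z ∷ []) (r ∷ s ∷ [])) ≡ link x y r ℙ.+ link y z s
value-parityRule #       #       z       r s = refl
value-parityRule (bit _) #       z       r s = refl
value-parityRule #       (bit _) #       r s = refl
value-parityRule #       (bit _) (bit _) r s = refl
value-parityRule (bit _) (bit _) #       r s = sym (ℙₚ.+-identityʳ r)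
value-parityRule (bit _) (bit _) (bit _) r s = refl

isBlank-parityRule : ∀ x y z r s → isBlank (parityRule (x ∷ y ∷ z ∷ []) (r ∷ s ∷ [])) ≡ isBlank y
isBlank-parityRule #       #       z       r s = refl
isBlank-parityRule (bit _) #       z       r s = refl
isBlank-parityRule #       (bit _) #       r s = refl
isBlank-parityRule #       (bit _) (bit _) r s = refl
isBlank-parityRule (bit _) (bit _) #       r s = refl
isBlank-parityRule (bit _) (bit _) (bit _) r s = refl

isBlank-Parity : ∀ c s z → isBlank (global Parity c s z) ≡ isBlank (c z)
isBlank-Parity c s z = trans
  (isBlank-parityRule (c (z ℤ.+ -1ℤ)) (c (z ℤ.+ 0ℤ)) (c (z ℤ.+ 1ℤ)) (s (z ℤ.+ -1ℤ)) (s (z ℤ.+ 0ℤ)))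
  (cong (isBlank ∘ c) (ℤₚ.+-identityʳ z))

-- The values telescope, because every random symbol is added to the two cells
-- at its boundary; nothing is added across the boundary of a cell in state #.
-- There may be further # inside the window.
total-Parity : ∀ c s a n → c a ≡ # → c (a ℤ.+ + n) ≡ # →
  total (factor (global Parity c s) a (suc n)) ≡ 0ℙ
total-Parity c s a n ca≡# cb≡# = begin
  total (factor (global Parity c s) a (suc n))  ≡⟨ total-telescopes (suc n) (λ i → global Parity c s (a ℤ.+ + i)) h value-h ⟩
  h 0 ℙ.+ h (suc n)                             ≡⟨ cong₂ ℙ._+_ h-left h-right ⟩
  0ℙ                                            ∎
  where
  open ≡-Reasoning
  -- The contribution across the boundary on the left of the cell p.
  b : ℤ → Bit
  b p = link (c (p ℤ.+ -1ℤ)) (c (p ℤ.+ 0ℤ)) (s (p ℤ.+ -1ℤ))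
  h : ℕ → Bit
  h i = b (a ℤ.+ + i)
  pred-suc : ∀ a i → a ℤ.+ (1ℤ ℤ.+ i) ℤ.+ -1ℤ ≡ a ℤ.+ i ℤ.+ 0ℤ
  pred-suc = solve-∀
  suc-shift : ∀ a i → a ℤ.+ (1ℤ ℤ.+ i) ℤ.+ 0ℤ ≡ a ℤ.+ i ℤ.+ 1ℤ
  suc-shift = solve-∀
  pred-suc′ : ∀ a i → a ℤ.+ (1ℤ ℤ.+ i) ℤ.+ -1ℤ ≡ a ℤ.+ i
  pred-suc′ = solve-∀
  h-suc : ∀ i → let p = a ℤ.+ + i in h (suc i) ≡ link (c (p ℤ.+ 0ℤ)) (c (p ℤ.+ 1ℤ)) (s (p ℤ.+ 0ℤ))
  h-suc i rewrite pred-suc a (+ i) | suc-shift a (+ i) = refl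
  value-h : ∀ i → value (global Parity c s (a ℤ.+ + i)) ≡ h i ℙ.+ h (suc i)
  value-h i = let p = a ℤ.+ + i in trans
    (value-parityRule (c (p ℤ.+ -1ℤ)) (c (p ℤ.+ 0ℤ)) (c (p ℤ.+ 1ℤ)) (s (p ℤ.+ -1ℤ)) (s (p ℤ.+ 0ℤ)))
    (cong (h i ℙ.+_) (sym (h-suc i)))
  h-left : h 0 ≡ 0ℙ
  h-left rewrite ℤₚ.+-identityʳ a | ℤₚ.+-identityʳ a | ca≡# = link-#ʳ (c (a ℤ.+ -1ℤ)) _
  h-right : h (suc n) ≡ 0ℙ
  h-right rewrite pred-suc′ a (+ n) | cb≡# = refl

-- Modified configurations

-- s with the symbol at the cell z taken from s′.
replaceAt : ∀ {A : Set} → ℤ → Config A → Config A → Config A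
replaceAt z s s′ p = if ⌊ p ℤₚ.≟ z ⌋ then s′ p else s p

replaceAt-≡ : ∀ {A : Set} z (s s′ : Config A) → replaceAt z s s′ z ≡ s′ z
replaceAt-≡ z s s′ with z ℤₚ.≟ z
... | yes _  = refl
... | no z≢z = contradiction refl z≢z

replaceAt-≢ : ∀ {A : Set} {z p} (s s′ : Config A) → p ≢ z → s p ≡ replaceAt z s s′ p
replaceAt-≢ {z = z} {p} s s′ p≢z with p ℤₚ.≟ z
... | yes p≡z = contradiction p≡z p≢z
... | no _    = refl

-- c with a # written on every cell at distance more than N from z.
truncate : ℕ → ℤ → Config State → Config State
truncate N z c p = if ⌊ ∣ p ℤ.- z ∣ ℕ.≤? N ⌋ then c p else #

truncate-near : ∀ N z c p → ∣ p ℤ.- z ∣ ℕ.≤ N → c p ≡ truncate N z c p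
truncate-near N z c p near with ∣ p ℤ.- z ∣ ℕ.≤? N
... | yes _  = refl
... | no far = contradiction near far

truncate-far : ∀ N z c p → N ℕ.< ∣ p ℤ.- z ∣ → truncate N z c p ≡ #
truncate-far N z c p far with ∣ p ℤ.- z ∣ ℕ.≤? N
... | yes near = contradiction near (ℕₚ.<⇒≱ far)
... | no _     = refl

-- The cells at distance at most N + 1 from z form a window, from a to a + n,
-- that ends in # on either side; z is its cell number k.
truncate-ends : ∀ N z c → ∃ λ a → ∃ λ n → ∃ λ (k : Fin (suc n)) →
  (a ℤ.+ + toℕ k ≡ z) × (truncate N z c a ≡ #) × (truncate N z c (a ℤ.+ + n) ≡ #)
truncate-ends N z c = z ℤ.- + l , l ℕ.+ l , fromℕ< l<1+n
  , trans (cong (λ i → z ℤ.- + l ℤ.+ + i) (Finₚ.toℕ-fromℕ< l<1+n)) (centre z (+ l))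
  , truncate-far N z c _ (ℕₚ.≤-reflexive (sym (trans (cong ∣_∣ (left z (+ l))) (ℤₚ.∣-i∣≡∣i∣ (+ l)))))
  , truncate-far N z c _ (ℕₚ.≤-reflexive (sym (cong ∣_∣ (right z (+ l)))))
  where
  l = suc N
  l<1+n : l ℕ.< suc (l ℕ.+ l)
  l<1+n = ℕ.s≤s (ℕₚ.m≤m+n l l)
  centre : ∀ z k → z ℤ.- k ℤ.+ k ≡ z
  centre = solve-∀
  left : ∀ z k → z ℤ.- k ℤ.- z ≡ ℤ.- k
  left = solve-∀
  right : ∀ z k → z ℤ.- k ℤ.+ (k ℤ.+ k) ℤ.- z ≡ k
  right = solve-∀

-- Correlation-free automata with the law of Parity

module _ (F : StochasticCA State) (t : ℕ) (same : 𝒮^ F t ≋ 𝒮 Parity) where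

  outcome-of-Parity : ∀ c s z n → ∃ λ s′ → factor (global Parity c s′) z n ≡ factor (iterate F t c s) z n
  outcome-of-Parity c s z n =
    let u       = factor (iterate F t c s) z n
        s′ , eq = support-transfer F Parity t 1 c c z u (trans (same c z u) (𝒮≡𝒮^1 Parity c z u)) (s , refl)
    in s′ Fin.zero , eq

  outcome-of-F : ∀ c s z n → ∃ λ s′ → factor (iterate F t c s′) z n ≡ factor (global Parity c s) z n
  outcome-of-F c s z n =
    let u = factor (global Parity c s) z n
    in support-transfer Parity F 1 t c c z u (sym (trans (same c z u) (𝒮≡𝒮^1 Parity c z u))) ((λ _ → s) , refl)

  isBlank-preserved : ∀ c s z → isBlank (iterate F t c s z) ≡ isBlank (c z)
  isBlank-preserved c s z =
    let s′ , eq = outcome-of-Parity c s z 1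
        eq′ = subst (λ p → global Parity c s′ p ≡ iterate F t c s p) (ℤₚ.+-identityʳ z)
                (cong Vec.head eq)
    in trans (cong isBlank (sym eq′)) (isBlank-Parity c s′ z)

  total-even : ∀ c s a n → c a ≡ # → c (a ℤ.+ + n) ≡ # → total (factor (iterate F t c s) a (suc n)) ≡ 0ℙ
  total-even c s a n ca cb =
    let s′ , eq = outcome-of-Parity c s a (suc n)
    in trans (cong total (sym eq)) (total-Parity c s′ a n ca cb)

module _ (F : StochasticCA State) (cfca : IsCFCA F) (m : ℕ) (same : 𝒮^ F (suc m) ≋ 𝒮 Parity) where

  -- If the symbol read at z is replaced, the other cells of the window keep their
  -- states, z keeps its blankness, and the total stays even.
  last-step-deterministic-between : ∀ c a n → c a ≡ # → c (a ℤ.+ + n) ≡ # →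
    ∀ u s s′ (k : Fin (suc n)) → let d = iterate F m c u; z = a ℤ.+ + toℕ k in
    global F d s z ≡ global F d s′ z
  last-step-deterministic-between c a n ca cb u s s′ k = trans
    (isBlank-value-injective
      (trans (isBlank-outcome s) (sym (isBlank-outcome s″)))
      (total-agree-elsewhere (outcome s) (outcome s″) k elsewhere
        (trans (total-outcome s) (sym (total-outcome s″)))))
    (global-local-symbols F cfca d s″ s′ z (replaceAt-≡ z s s′))
    where
    d = iterate F m c u
    z = a ℤ.+ + toℕ k
    s″ = replaceAt z s s′
    outcome : Config (R F) → Fin (suc n) → State
    outcome σ i = global F d σ (a ℤ.+ + toℕ i)
    elsewhere : ∀ i → i ≢ k → outcome s i ≡ outcome s″ i
    elsewhere i i≢k = let p = a ℤ.+ + toℕ i in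
      global-local-symbols F cfca d s s″ p
        (replaceAt-≢ s s′ λ eq →
          i≢k (Finₚ.toℕ-injective (ℤₚ.+-injective (∙-cancelˡ ℤₚ.+-0-abelianGroup a (+ toℕ i) (+ toℕ k) eq))))
    isBlank-outcome : ∀ σ → isBlank (global F d σ z) ≡ isBlank (c z)
    isBlank-outcome σ = let w , eq = iterate-snoc F m u σ in
      trans (cong (λ e → isBlank (e z)) (eq c)) (isBlank-preserved F (suc m) same c w z)
    total-outcome : ∀ σ → total (factor (global F d σ) a (suc n)) ≡ 0ℙ
    total-outcome σ = let w , eq = iterate-snoc F m u σ in
      trans (cong (λ e → total (factor e a (suc n))) (eq c)) (total-even F (suc m) same c w a n ca cb)

  last-step-deterministic : ∀ {d} → Reachable F m d → Deterministic F d
  last-step-deterministic {d} (c , u , refl) s s′ z = begin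
    global F (iterate F m c u) s z    ≡⟨ truncated s ⟩
    global F (iterate F m c′ u) s z   ≡⟨ centre ⟩
    global F (iterate F m c′ u) s′ z  ≡⟨ truncated s′ ⟨
    global F (iterate F m c u) s′ z   ∎
    where
    open ≡-Reasoning
    -- The dependence of F^t on the initial configuration, for t = m + 1.
    N = suc m ℕ.* radius F
    c′ = truncate N z c
    centre : global F (iterate F m c′ u) s z ≡ global F (iterate F m c′ u) s′ z
    centre =
      let a , n , k , z≡ , left , right = truncate-ends N z c
      in subst (λ p → global F (iterate F m c′ u) s p ≡ global F (iterate F m c′ u) s′ p) z≡
           (last-step-deterministic-between c′ a n left right u s s′ k)
    truncated : ∀ σ → global F (iterate F m c u) σ z ≡ global F (iterate F m c′ u) σ z
    truncated σ = let w , eq = iterate-snoc F m u σ in begin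
      global F (iterate F m c u) σ z   ≡⟨ cong (λ e → e z) (eq c) ⟩
      iterate F (suc m) c w z          ≡⟨ iterate-local-config F (suc m) w z (truncate-near N z c) ⟩
      iterate F (suc m) c′ w z         ≡⟨ cong (λ e → e z) (eq c′) ⟨
      global F (iterate F m c′ u) σ z  ∎

-- If F^t can lead from c back to c, then its outcome on c does not depend on the
-- random symbols.
returning-constant : (F : StochasticCA State) → IsCFCA F → ∀ t → 𝒮^ F t ≋ 𝒮 Parity →
  ∀ c w → c ≗ iterate F t c w → ∀ s s′ → iterate F t c s ≗ iterate F t c s′
returning-constant F cfca zero    same c w returns s s′ z = refl
returning-constant F cfca (suc m) same c w returns s s′ z = begin
  iterate F (suc m) c s z   ≡⟨ iterate-local-config F (suc m) s z (λ p _ → returns p) ⟩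
  iterate F (suc m) d s z   ≡⟨ iterate-deterministic F (last-step-deterministic F cfca m same) reachable (suc m) s s′ z ⟩
  iterate F (suc m) d s′ z  ≡⟨ iterate-local-config F (suc m) s′ z (λ p _ → returns p) ⟨
  iterate F (suc m) c s′ z  ∎
  where
  open ≡-Reasoning
  d = iterate F (suc m) c w
  reachable : Reachable F m d
  reachable = Reachable-forget F (c , w , refl)

-- The configuration …##00##….
twoZeros : Config State
twoZeros (+ 0) = bit 0ℙ
twoZeros (+ 1) = bit 0ℙ
twoZeros _     = #

twoZeros-unique : ∀ d → (∀ z → isBlank (d z) ≡ isBlank (twoZeros z)) →
  factor d 0ℤ 2 ≡ factor twoZeros 0ℤ 2 → twoZeros ≗ d
twoZeros-unique d marks eq (+ 0)           = sym (cong (λ w → lookup w Fin.zero) eq)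
twoZeros-unique d marks eq (+ 1)           = sym (cong (λ w → lookup w (Fin.suc Fin.zero)) eq)
twoZeros-unique d marks eq (+ suc (suc k)) = sym (isBlank⇒≡# (marks (+ suc (suc k))))
twoZeros-unique d marks eq -[1+ k ]        = sym (isBlank⇒≡# (marks -[1+ k ]))

Parity-00 : factor (global Parity twoZeros λ _ → 0ℙ) 0ℤ 2 ≡ factor twoZeros 0ℤ 2
Parity-00 = refl

Parity-00≢11 : factor (global Parity twoZeros λ _ → 0ℙ) 0ℤ 2 ≢ factor (global Parity twoZeros λ _ → 1ℙ) 0ℤ 2
Parity-00≢11 ()

theorem5p5 : (F : StochasticCA State) → IsCFCA F → (t : ℕ) → 𝒮^ F t ≉ 𝒮 Parity
theorem5p5 F cfca t same =
  let s  , zeros = outcome-of-F F t same twoZeros (λ _ → 0ℙ) 0ℤ 2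
      s′ , ones  = outcome-of-F F t same twoZeros (λ _ → 1ℙ) 0ℤ 2
      returns    = twoZeros-unique (iterate F t twoZeros s)
                     (isBlank-preserved F t same twoZeros s) (trans zeros Parity-00)
      constant   = Vecₚ.tabulate-cong λ i →
                     returning-constant F cfca t same twoZeros s returns s s′ (0ℤ ℤ.+ + toℕ i)
  in Parity-00≢11 (trans (sym zeros) (trans constant ones))
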